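{- Let $G(s)=(V,E)$ be a labelled finite graph (loops and multiple edges allowed) with $|E|=n$, and let $f$ be a discrete harmonic function on $E$ (that is, $f\in\mathrm{Harm}_d(n)$, transported to $E$ by the label $s$). Then, with $\lambda=1+q$, $$\chi_f(G(s);\lambda)=\sum_i(-1)^{i+1}\cdot fq\mathrm{dim}\big(C^i(G(s))\big).$$ Also, with $\lambda=1+q$, $$\widehat\chi_f(G;\lambda)=\sum_{s}\sum_i(-1)^{i+1}\cdot fq\mathrm{dim}\big(C^i(G(s))\big),$$ where the outer sum runs over all labels $s$ of $G$.
   Context: Let $\Omega=\{1,\dots,n\}$ and $\Omega_d=\{Z\subset\Omega:|Z|=d\}$. Functions $f:\Omega_d\to\mathbb R$ are identified with formal sums $f=\sum_{Z\in\Omega_d}f(Z)Z\in\mathbb R\Omega_d$. Let $\gamma$ be the linear map with $\gamma(Z)=\sum_{Y\in\Omega_{d-1},\,Y\subset Z}Y$ for $Z\in\Omega_d$; $\mathrm{Harm}_d(n)=\ker(\gamma|_{\mathbb R\Omega_d})$, and its elements are the discrete harmonic functions of degree $d$. For $X\subset\Omega$ put $\widetilde f(X)=\sum_{Z\in\Omega_d,\,Z\subset X}f(Z)$. A label of $G$ is a bijection $s:E\to\Omega$; $S(G)$ is the set of all labels, and $G(s)$ denotes $G$ with edges indexed by $s$. For $A\subset E$, $G_A=(V,A)$ and $k(G_A)$ is its number of connected components. The weighted chromatic polynomial is $\chi_f(G(s);\lambda)=\sum_{A\subset E}\widetilde f(s(E\setminus A))(-1)^{|A|}\lambda^{k(G_A)}$,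 and $\widehat\chi_f(G;\lambda)=\sum_{s\in S(G)}\chi_f(G(s);\lambda)$. Let $M=M_0\oplus M_1$ be the graded free $\mathbb Z$-module with $M_0$ generated by the basis element $1$ in degree $0$ and $M_1$ generated by the basis element $x$ in degree $1$. Spanning subgraphs of $G(s)$ correspond to edge vectors $\epsilon\in\{0,1\}^n$, where $\epsilon_i=1$ iff the $i$-th edge is present; $G_\epsilon$ is the corresponding spanning subgraph and $l(\epsilon)$ the number of ones in $\epsilon$. The $i$-th chromatic cochain group is the graded module $$C^i(G(s))=\bigoplus_{l(\epsilon)=i}M^{\otimes k(G_\epsilon)}.$$ The summand indexed by $\epsilon$ is assigned the $f$-value of the corresponding edge set, namely $\widetilde f(\{j:\epsilon_j=1\})$. For a $\mathbb Z$-module $N=\bigoplus_j N_j$ whose summands have $f$-values $f(N_j)$, $f\mathrm{rank}(N)=\sum_j f(N_j)\cdot\dim_{\mathbb Q}(N_j\otimes\mathbb Q)$. For a graded module $\mathcal N$ with degree-$j$ homogeneous part $N_j$ (decomposed into parts with $f$-values), the $f$-value graded dimension is $fq\mathrm{dim}(\mathcal N)=\sum_j q^j\cdot f\mathrm{rank}(N_j)$. For instance, the summand indexed by $\epsilon$ contributes $\widetilde f(\{j:\epsilon_j=1\})(1+q)^{k(G_\epsilon)}$.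
   Formalization: In both formulas the sign (-1)^{i+1} is replaced by (-1)^{i+d}, where d is the degree of f; they agree for odd d, but for even d the printed sign is wrong (one vertex, no edges, d=0, f(∅)=1: the left side is 1+q, the printed right side is -(1+q)). -}

module Defs where

open import Level using (Level; _⊔_)
open import Algebra.Bundles using (CommutativeRing; Semiring)
import Algebra.Definitions.RawSemiring as RawSemiringDefinitions
open import Data.Bool.Base using (if_then_else_)
open import Data.Fin.Base using (Fin)
open import Data.Fin.Properties using (_≟_; any?; all?)
open import Data.Fin.Subset
  using (Subset; inside; outside; ∣_∣; ∁; _⊆_)
open import Data.Fin.Subset.Properties using (_∈?_; _⊆?_)
open import Data.List.Base
  using (List; []; _∷_; [_]; map; concatMap; cartesianProduct; cartesianProductWith;
         filter; foldr; deduplicate; length; allFin; upTo)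
open import Data.List.Membership.Propositional using (_∈_)
open import Data.List.Relation.Unary.Any using (here; there)
open import Data.Nat.Base as ℕ using (ℕ; zero; suc)
import Data.Nat.Properties as ℕ
open import Data.Product.Base using (Σ; _×_; _,_; proj₁; proj₂)
open import Data.Sum.Base using (_⊎_; inj₁; inj₂)
open import Data.Unit.Base using (⊤; tt)
open import Data.Vec.Base using (Vec; []; _∷_; lookup; tabulate)
open import Function.Base using (_∘_)
open import Function.Definitions using (Injective; Surjective; Bijective)
open import Relation.Binary.Construct.Closure.Equivalence as Eq using (EqClosure)
open import Relation.Binary.Construct.Closure.ReflexiveTransitive as Star using (_◅_)
open import Relation.Binary.Construct.Closure.Symmetric using (SymClosure; fwd; bwd)
open import Relation.Binary.Core using (Rel)
open import Relation.Binary.Definitions using (Decidable)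
open import Relation.Binary.PropositionalEquality.Core using (_≡_; refl; sym; trans; cong)
open import Relation.Nullary.Decidable.Core
  using (Dec; yes; no; does; map′; _×-dec_; _⊎-dec_; _→-dec_)

vectors : ∀ {a} {A : Set a} → List A → ∀ n → List (Vec A n)
vectors xs zero    = [ [] ]
vectors xs (suc n) = cartesianProductWith _∷_ xs (vectors xs n)

subsets : ∀ n → List (Subset n)
subsets = vectors (outside ∷ inside ∷ [])

Ω[_] : ℕ → ℕ → Set
Ω[ d ] n = Σ (Subset n) λ Z → ∣ Z ∣ ≡ d

ofSize : ∀ d {n} → Subset n → List (Ω[ d ] n)
ofSize d Z with ∣ Z ∣ ℕ.≟ d
... | yes ∣Z∣≡d = [ Z , ∣Z∣≡d ]
... | no  _     = []

Ω-elements : ∀ d n → List (Ω[ d ] n)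
Ω-elements d n = concatMap (ofSize d) (subsets n)

------------------------------------------------------------------------

-- The edge set is Fin n and is kept apart from Ω = {1,…,n}, which is also
-- modelled by Fin n: the two are identified only through a label.  An edge
-- with equal ends is a loop; the order of the two ends is irrelevant below.

record Graph (n : ℕ) : Set where
  field
    order : ℕ
    ends  : Fin n → Fin order × Fin order

  edges : Subset n → List (Fin order × Fin order)
  edges A = map ends (filter (_∈? A) (allFin n))

Connected : ∀ {v} → List (Fin v × Fin v) → Rel (Fin v) _
Connected es = EqClosure (λ x y → (x , y) ∈ es)

connected? : ∀ {v} (es : List (Fin v × Fin v)) → Decidable (Connected es)
connected? [] x y = map′ (λ { refl → Star.ε }) from (x ≟ y)
  where
  from : ∀ {x y} → Connected [] x y → x ≡ y
  from Star.ε             = refl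
  from (fwd () ◅ _)
  from (bwd () ◅ _)
connected? {v} ((a , b) ∷ es) x y = map′ to (Star.fold Via step (inj₁ Star.ε))
  (connected? es x y
   ⊎-dec (connected? es x a ×-dec connected? es b y)
   ⊎-dec (connected? es x b ×-dec connected? es a y))
  where
  Via : Rel (Fin v) _
  Via x y = Connected es x y
          ⊎ (Connected es x a × Connected es b y)
          ⊎ (Connected es x b × Connected es a y)

  weaken : ∀ {x y} → Connected es x y → Connected ((a , b) ∷ es) x y
  weaken = Eq.map there

  to : ∀ {x y} → Via x y → Connected ((a , b) ∷ es) x y
  to (inj₁ p)              = weaken p
  to (inj₂ (inj₁ (p , r))) = weaken p Star.◅◅ (fwd (here refl) ◅ weaken r)
  to (inj₂ (inj₂ (p , r))) = weaken p Star.◅◅ (bwd (here refl) ◅ weaken r)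

  extend : ∀ {x y z} → SymClosure (λ x y → (x , y) ∈ es) x y → Via y z → Via x z
  extend e (inj₁ p)              = inj₁ (e ◅ p)
  extend e (inj₂ (inj₁ (p , r))) = inj₂ (inj₁ (e ◅ p , r))
  extend e (inj₂ (inj₂ (p , r))) = inj₂ (inj₂ (e ◅ p , r))

  step : ∀ {x y z} → SymClosure (λ x y → (x , y) ∈ (a , b) ∷ es) x y → Via y z → Via x z
  step (fwd (there e))   p                     = extend (fwd e) p
  step (bwd (there e))   p                     = extend (bwd e) p
  step (fwd (here refl)) (inj₁ p)              = inj₂ (inj₁ (Star.ε , p))
  step (fwd (here refl)) (inj₂ (inj₁ (_ , r))) = inj₂ (inj₁ (Star.ε , r))
  step (fwd (here refl)) (inj₂ (inj₂ (_ , r))) = inj₁ r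
  step (bwd (here refl)) (inj₁ p)              = inj₂ (inj₂ (Star.ε , p))
  step (bwd (here refl)) (inj₂ (inj₁ (_ , r))) = inj₁ r
  step (bwd (here refl)) (inj₂ (inj₂ (_ , r))) = inj₂ (inj₂ (Star.ε , r))

-- Deduplicating the vertices up to connectedness leaves one vertex in each
-- component.

k : ∀ {n} (G : Graph n) → Subset n → ℕ
k G A = length (deduplicate (connected? (edges A)) (allFin order))
  where open Graph G

IsLabel : ∀ {n} → (Fin n → Fin n) → Set
IsLabel = Bijective _≡_ _≡_

isLabel? : ∀ {n} (s : Fin n → Fin n) → Dec (IsLabel s)
isLabel? s = injective? ×-dec surjective?
  where
  injective? : Dec (Injective _≡_ _≡_ s)
  injective? = map′ (λ p {x} {y} → p x y) (λ p x y → p)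
    (all? λ x → all? λ y → (s x ≟ s y) →-dec (x ≟ y))

  surjective? : Dec (Surjective _≡_ _≡_ s)
  surjective? = map′
    (λ p y → proj₁ (p y) , λ z≡x → trans (cong s z≡x) (proj₂ (p y)))
    (λ p y → proj₁ (p y) , proj₂ (p y) refl)
    (all? λ y → any? λ x → s x ≟ y)

labels : ∀ n → List (Fin n → Fin n)
labels n = filter isLabel? (map lookup (vectors (allFin n) n))

image : ∀ {n} → (Fin n → Fin n) → Subset n → Subset n
image s A = tabulate λ i → does (any? λ e → (e ∈? A) ×-dec (s e ≟ i))

-- Here ε refers to edges by their labels, so G_ε has edge set s⁻¹{j : ε_j = 1}.

spanning : ∀ {n} → (Fin n → Fin n) → Subset n → Subset n
spanning s ε = tabulate (lookup ε ∘ s)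

------------------------------------------------------------------------

-- A finitely generated free graded ℤ-module, presented by a finite homogeneous
-- ℤ-basis.

record GradedModule : Set₁ where
  field
    Basis  : Set
    basis  : List Basis
    degree : Basis → ℕ

  -- The degree-j part N_j is free on the basis elements of degree j, and these
  -- form a ℚ-basis of N_j ⊗ ℚ.
  dim : ℕ → ℕ
  dim j = length (filter (λ b → degree b ℕ.≟ j) basis)

  topDegree : ℕ
  topDegree = foldr ℕ._⊔_ 0 (map degree basis)

open GradedModule

ℤ₀ : GradedModule
ℤ₀ = record { Basis = ⊤ ; basis = [ tt ] ; degree = λ _ → 0 }

data MBasis : Set where
  𝟏 𝒙 : MBasis

M : GradedModule
M = record { Basis = MBasis ; basis = 𝟏 ∷ 𝒙 ∷ [] ; degree = λ { 𝟏 → 0 ; 𝒙 → 1 } }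

infixr 7 _⊗_

_⊗_ : GradedModule → GradedModule → GradedModule
N ⊗ P = record
  { Basis  = Basis N × Basis P
  ; basis  = cartesianProduct (basis N) (basis P)
  ; degree = λ (b , b′) → degree N b ℕ.+ degree P b′
  }

M⊗^ : ℕ → GradedModule
M⊗^ zero    = ℤ₀
M⊗^ (suc m) = M ⊗ M⊗^ m

------------------------------------------------------------------------

-- Functions take values in a commutative ring K, in place of ℝ.  The ring may
-- itself be a polynomial ring, so identities at every q ∈ K include identities
-- of polynomials in an indeterminate q.

module Weighted {c ℓ : Level} (K : CommutativeRing c ℓ) where

  open CommutativeRing K renaming (Carrier to 𝕂) hiding (refl; sym; trans)
  open RawSemiringDefinitions (Semiring.rawSemiring semiring) public using (_^_) renaming (_×_ to _·_)

  TorsionFree : Set (c ⊔ ℓ)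
  TorsionFree = ∀ m x → suc m · x ≈ 0# → x ≈ 0#

  ∑ : ∀ {a} {A : Set a} → List A → (A → 𝕂) → 𝕂
  ∑ xs g = foldr _+_ 0# (map g xs)

  infix 5 ∑
  syntax ∑ xs (λ x → e) = ∑[ x ← xs ] e

  module _ {n : ℕ} where

    -- The degree of the image is e with suc e = d, rather than d ∸ 1, so that
    -- Ω_{-1} is empty when d = 0 (and γ vanishes there).

    γ⟨_⟩ : ∀ {d} → Ω[ d ] n → Σ (Subset n) (λ Y → suc ∣ Y ∣ ≡ d) → 𝕂
    γ⟨ Z , _ ⟩ (Y , _) = if does (Y ⊆? Z) then 1# else 0#

    γ : ∀ {d} → (Ω[ d ] n → 𝕂) → Σ (Subset n) (λ Y → suc ∣ Y ∣ ≡ d) → 𝕂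
    γ {d} f Y = ∑[ Z ← Ω-elements d n ] (f Z * γ⟨ Z ⟩ Y)

    Harm : ∀ d → (Ω[ d ] n → 𝕂) → Set ℓ
    Harm d f = ∀ Y → γ f Y ≈ 0#

    tilde : ∀ {d} → (Ω[ d ] n → 𝕂) → Subset n → 𝕂
    tilde {d} f X = ∑[ Z ← filter (λ Z → proj₁ Z ⊆? X) (Ω-elements d n) ] f Z

    χ : ∀ {d} → (Ω[ d ] n → 𝕂) → Graph n → (Fin n → Fin n) → 𝕂 → 𝕂
    χ f G s x = ∑[ A ← subsets n ] (tilde f (image s (∁ A)) * (- 1#) ^ ∣ A ∣ * x ^ k G A)

    χ̂ : ∀ {d} → (Ω[ d ] n → 𝕂) → Graph n → 𝕂 → 𝕂
    χ̂ f G x = ∑[ s ← labels n ] χ f G s x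

  -- A direct sum of graded modules, each summand carrying an f-value.

  record Summand : Set (c ⊔ Level.suc Level.zero) where
    constructor _at_
    field
      underlying : GradedModule
      value      : 𝕂

  open Summand public

  ValuedModule : Set (c ⊔ Level.suc Level.zero)
  ValuedModule = List Summand

  frank : ℕ → ValuedModule → 𝕂
  frank j N = ∑[ P ← N ] (dim (underlying P) j · value P)

  fqdim : 𝕂 → ValuedModule → 𝕂
  fqdim q N = ∑[ j ← upTo (suc top) ] (q ^ j * frank j N)
    where top = foldr ℕ._⊔_ 0 (map (topDegree ∘ underlying) N)

  module _ {n : ℕ} where

    C : ∀ {d} → (Ω[ d ] n → 𝕂) → Graph n → (Fin n → Fin n) → ℕ → ValuedModule
    C f G s i = map (λ ε → M⊗^ (k G (spanning s ε)) at tilde f ε)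
                    (filter (λ ε → ∣ ε ∣ ℕ.≟ i) (subsets n))

{-# OPTIONS --safe #-}

-- View g : Subset n → K as the multilinear polynomial p(x) = Σ g(Z) x^Z, so
-- that f̃(X) is the value of p at the indicator vector of X.  Harmonicity says
-- that the sum of the partial derivatives of p vanishes, so, in the absence of
-- torsion, p is invariant under translation by (1,…,1).  Homogeneity then gives
-- f̃(Ω ∖ X) = p(1 − x) = p(− x) = (−1)^d f̃(X).  Rewriting χ_f with this and
-- indexing subgraphs by the labels of their edges, the contribution of ε is,
-- up to its sign, f̃(ε) times the graded dimension (1 + q)^k of M^{⊗k}.

module Submission where

open import Defs
open import Algebra.Bundles using (CommutativeRing)
import Algebra.Properties.CommutativeMonoid.Mult as CommutativeMonoidMult
import Algebra.Properties.CommutativeMonoid.Sum as CommutativeMonoidSum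
import Algebra.Properties.CommutativeSemigroup as CommutativeSemigroupProperties
import Algebra.Properties.Group as GroupProperties
import Algebra.Properties.Ring as RingProperties
import Algebra.Properties.Semiring.Exp as SemiringExp
open import Data.Bool.Base using (Bool; true; false; if_then_else_; not)
open import Data.Fin.Base using (Fin; zero; suc)
open import Data.Fin.Permutation using (Permutation′; _⟨$⟩ˡ_; inverseˡ)
open import Data.Fin.Properties using (_≟_; any?)
open import Data.Fin.Subset using (Subset; inside; outside; ∣_∣; ∁)
import Data.Fin.Subset as Subset
open import Data.Fin.Subset.Properties using (_∈?_; _⊆?_; ∣p∣≤n)
open import Data.List.Base
  using (List; []; _∷_; map; _++_; concatMap; cartesianProductWith; filter; foldr; length;
         allFin; applyUpTo; upTo)
open import Data.List.Membership.Propositional using (_∈_)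
open import Data.List.Membership.Propositional.Properties
  using (∈-cartesianProductWith⁺; ∈-filter⁻; ∈-map⁺)
open import Data.List.Properties using (map-∘; map-upTo)
open import Data.List.Relation.Binary.Permutation.Propositional as ↭ using (_↭_)
open import Data.List.Membership.Propositional.Properties.WithK
  using (unique∧set⇒bag)
open import Data.List.Relation.Binary.BagAndSetEquality using (∼bag⇒↭)
import Data.List.Relation.Unary.All as All
import Data.List.Relation.Unary.AllPairs as AllPairs
open import Data.List.Relation.Unary.Any using (here; there)
open import Data.List.Relation.Unary.Unique.Propositional using (Unique)
import Data.List.Relation.Unary.Unique.Propositional.Properties as Unique
open import Data.Nat.Base as ℕ using (ℕ; zero; suc; _≤_; _<_; s≤s)
import Data.Nat.Properties as ℕ
open import Data.Product.Base using (∃; _×_; _,_; proj₁; proj₂)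
open import Data.Vec.Base using ([]; _∷_; lookup; tabulate)
open import Data.Vec.Properties
  using (∷-injective; lookup∘tabulate; tabulate∘lookup; tabulate-cong; tabulate-∘; lookup-map;
         lookup⇒[]=; []=⇒lookup)
open import Function.Base using (_∘_)
open import Function.Bundles using (mk⤖; mk⇔)
open import Function.Properties.Bijection using (⤖⇒↔)
open import Level using (Level)
open import Relation.Binary.PropositionalEquality as ≡ using (_≡_; _≢_)
import Relation.Binary.Reasoning.Setoid as SetoidReasoning
open import Relation.Nullary.Decidable.Core using (yes; no; does; _×-dec_)
open import Relation.Nullary.Decidable using (does-⇔)
open import Relation.Nullary.Negation using (contradiction)
open import Relation.Unary using (Pred; Decidable)

private
  variable
    a b p : Level
    A : Set a
    B : Set b

-- Guarantees that the degree range summed over in `fqdim` omits no basis element.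
∈⇒≤foldr-⊔ : ∀ {m} {ms : List ℕ} → m ∈ ms → m ≤ foldr ℕ._⊔_ 0 ms
∈⇒≤foldr-⊔ (here ≡.refl) = ℕ.m≤m⊔n _ _
∈⇒≤foldr-⊔ (there m∈ms)  = ℕ.≤-trans (∈⇒≤foldr-⊔ m∈ms) (ℕ.m≤n⊔m _ _)

-- Relabelling subsets

does-∈? : ∀ {n} (i : Fin n) X → does (i ∈? X) ≡ lookup X i
does-∈? zero    (inside  ∷ X) = ≡.refl
does-∈? zero    (outside ∷ X) = ≡.refl
does-∈? (suc i) (_       ∷ X) = does-∈? i X

-- Puts cardinality in a form to which invariance of sums under permutation of the index applies.
∣∣-as-sum : ∀ {n} (X : Subset n) →
  ∣ X ∣ ≡ CommutativeMonoidSum.sum ℕ.+-0-commutativeMonoid (λ i → if lookup X i then 1 else 0)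
∣∣-as-sum []            = ≡.refl
∣∣-as-sum (inside  ∷ X) = ≡.cong suc (∣∣-as-sum X)
∣∣-as-sum (outside ∷ X) = ∣∣-as-sum X

subsets-unique : ∀ n → Unique (subsets n)
subsets-unique zero    = All.[] AllPairs.∷ AllPairs.[]
subsets-unique (suc n) =
  Unique.cartesianProductWith⁺ _∷_ ∷-injective
    (((λ ()) All.∷ All.[]) AllPairs.∷ All.[] AllPairs.∷ AllPairs.[]) (subsets-unique n)

∈-subsets : ∀ {n} (X : Subset n) → X ∈ subsets n
∈-subsets []      = here ≡.refl
∈-subsets (x ∷ X) = ∈-cartesianProductWith⁺ _∷_ (∈-sides x) (∈-subsets X)
  where
  ∈-sides : ∀ x → x ∈ outside ∷ inside ∷ []
  ∈-sides outside = here ≡.refl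
  ∈-sides inside  = there (here ≡.refl)

module _ {n} {s : Fin n → Fin n} (s-label : IsLabel s) where

  private
    π : Permutation′ n
    π = ⤖⇒↔ (mk⤖ s-label)

  ∣spanning∣ : ∀ X → ∣ spanning s X ∣ ≡ ∣ X ∣
  ∣spanning∣ X = begin
    ∣ spanning s X ∣
      ≡⟨ ∣∣-as-sum (spanning s X) ⟩
    sum (λ i → if lookup (spanning s X) i then 1 else 0)
      ≡⟨ sum-cong-≗ (λ i → ≡.cong (λ x → if x then 1 else 0) (lookup∘tabulate (lookup X ∘ s) i)) ⟩
    sum (λ i → if lookup X (s i) then 1 else 0)
      ≡⟨ sum-permute (λ i → if lookup X i then 1 else 0) π ⟨
    sum (λ i → if lookup X i then 1 else 0)
      ≡⟨ ∣∣-as-sum X ⟨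
    ∣ X ∣ ∎
    where
    open ≡.≡-Reasoning
    open CommutativeMonoidSum ℕ.+-0-commutativeMonoid using (sum; sum-cong-≗; sum-permute)

  -- `spanning s X` is the preimage of `X` under `s`, and a surjection maps the preimage of a set
  -- onto that set.
  image-spanning : ∀ X → image s (spanning s X) ≡ X
  image-spanning X = ≡.trans (tabulate-cong pointwise) (tabulate∘lookup X)
    where
    from-image : ∀ {i} → (∃ λ e → e Subset.∈ spanning s X × s e ≡ i) → i Subset.∈ X
    from-image (e , e∈ , ≡.refl) = lookup⇒[]= (s e) X
      (≡.trans (≡.sym (lookup∘tabulate (lookup X ∘ s) e)) ([]=⇒lookup e∈))

    to-image : ∀ {i} → i Subset.∈ X → ∃ λ e → e Subset.∈ spanning s X × s e ≡ i
    to-image {i} i∈X with proj₂ s-label i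
    ... | e , s-hits with ≡.refl ← s-hits ≡.refl =
      e , lookup⇒[]= e _ (≡.trans (lookup∘tabulate (lookup X ∘ s) e) ([]=⇒lookup i∈X)) , ≡.refl

    pointwise : ∀ i → does (any? λ e → (e ∈? spanning s X) ×-dec (s e ≟ i)) ≡ lookup X i
    pointwise i = ≡.trans
      (does-⇔ (mk⇔ from-image to-image)
        (any? λ e → (e ∈? spanning s X) ×-dec (s e ≟ i)) (i ∈? X))
      (does-∈? i X)

  spanning-injective : ∀ {X Y} → spanning s X ≡ spanning s Y → X ≡ Y
  spanning-injective {X} {Y} eq =
    ≡.trans (≡.sym (image-spanning X)) (≡.trans (≡.cong (image s) eq) (image-spanning Y))

  ∁-spanning : ∀ X → ∁ (spanning s X) ≡ spanning s (∁ X)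
  ∁-spanning X = ≡.trans (≡.sym (tabulate-∘ not (lookup X ∘ s)))
    (tabulate-cong (λ i → ≡.sym (lookup-map (s i) not X)))

  image-∁-spanning : ∀ X → image s (∁ (spanning s X)) ≡ ∁ X
  image-∁-spanning X = ≡.trans (≡.cong (image s) (∁-spanning X)) (image-spanning (∁ X))

  -- The witness is the preimage of `X` under the inverse of `s`.
  spanning-surjective : ∀ X → X ≡ spanning s (spanning (π ⟨$⟩ˡ_) X)
  spanning-surjective X = ≡.trans (≡.sym (tabulate∘lookup X))
    (tabulate-cong λ i → ≡.trans (≡.cong (lookup X) (≡.sym (inverseˡ π)))
      (≡.sym (lookup∘tabulate (lookup X ∘ (π ⟨$⟩ˡ_)) (s i))))

  -- Two duplicate-free lists with the same members are permutations of each other. This allows a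
  -- sum over edge sets to be reindexed by sets of labels.
  spanning-↭ : map (spanning s) (subsets n) ↭ subsets n
  spanning-↭ = ∼bag⇒↭ (unique∧set⇒bag
    (Unique.map⁺ spanning-injective (subsets-unique n)) (subsets-unique n)
    (λ {X} → mk⇔ (λ _ → ∈-subsets X)
      (λ _ → ≡.subst (_∈ map (spanning s) (subsets n)) (≡.sym (spanning-surjective X))
               (∈-map⁺ (spanning s) (∈-subsets (spanning (π ⟨$⟩ˡ_) X))))))

module _ {c ℓ} (K : CommutativeRing c ℓ) where

  open CommutativeRing K renaming (Carrier to 𝕂)
  open Weighted K
  open GradedModule
  open SetoidReasoning setoid
  open CommutativeSemigroupProperties +-commutativeSemigroup using (interchange; x∙yz≈y∙xz)
  open CommutativeMonoidMult +-commutativeMonoid using ()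
    renaming (×-distrib-+ to ·-distrib-+; ×-congʳ to ·-congʳ)
  open GroupProperties +-group using () renaming (∙-cancelˡ to +-cancelˡ)
  open RingProperties ring using (-1*x≈-x)
  open SemiringExp semiring using (^-homo-*)

  -- Finite sums

  ∑-cong-∈ : (xs : List A) {g h : A → 𝕂} → (∀ {x} → x ∈ xs → g x ≈ h x) → ∑ xs g ≈ ∑ xs h
  ∑-cong-∈ []       g≈h = refl
  ∑-cong-∈ (x ∷ xs) g≈h = +-cong (g≈h (here ≡.refl)) (∑-cong-∈ xs (g≈h ∘ there))

  ∑-cong : (xs : List A) {g h : A → 𝕂} → (∀ x → g x ≈ h x) → ∑ xs g ≈ ∑ xs h
  ∑-cong xs g≈h = ∑-cong-∈ xs (λ {x} _ → g≈h x)

  ∑-zero : (xs : List A) → ∑ xs (λ _ → 0#) ≈ 0#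
  ∑-zero []       = refl
  ∑-zero (x ∷ xs) = trans (+-identityˡ _) (∑-zero xs)

  ∑-distrib-+ : (xs : List A) {g h : A → 𝕂} → ∑ xs (λ x → g x + h x) ≈ ∑ xs g + ∑ xs h
  ∑-distrib-+ []       = sym (+-identityˡ 0#)
  ∑-distrib-+ (x ∷ xs) = trans (+-congˡ (∑-distrib-+ xs)) (interchange _ _ _ _)

  *-distribˡ-∑ : ∀ (xs : List A) y {g : A → 𝕂} → y * ∑ xs g ≈ ∑ xs (λ x → y * g x)
  *-distribˡ-∑ []       y = zeroʳ y
  *-distribˡ-∑ (x ∷ xs) y = trans (distribˡ _ _ _) (+-congˡ (*-distribˡ-∑ xs y))

  *-distribʳ-∑ : ∀ (xs : List A) y {g : A → 𝕂} → ∑ xs g * y ≈ ∑ xs (λ x → g x * y)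
  *-distribʳ-∑ xs y = trans (*-comm _ _) (trans (*-distribˡ-∑ xs y) (∑-cong xs (λ _ → *-comm _ _)))

  ∑-++ : ∀ (xs ys : List A) {g : A → 𝕂} → ∑ (xs ++ ys) g ≈ ∑ xs g + ∑ ys g
  ∑-++ []       ys = sym (+-identityˡ _)
  ∑-++ (x ∷ xs) ys = trans (+-congˡ (∑-++ xs ys)) (sym (+-assoc _ _ _))

  ∑-map : ∀ (φ : A → B) xs {g : B → 𝕂} → ∑ (map φ xs) g ≈ ∑ xs (g ∘ φ)
  ∑-map φ xs = reflexive (≡.cong (foldr _+_ 0#) (≡.sym (map-∘ xs)))

  ∑-concatMap : ∀ (φ : A → List B) xs {g : B → 𝕂} →
    ∑ (concatMap φ xs) g ≈ ∑[ x ← xs ] (∑ (φ x) g)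
  ∑-concatMap φ []       = refl
  ∑-concatMap φ (x ∷ xs) = trans (∑-++ (φ x) _) (+-congˡ (∑-concatMap φ xs))

  ∑-cartesianProductWith : ∀ {c} {C : Set c} (φ : A → B → C) xs ys {g : C → 𝕂} →
    ∑ (cartesianProductWith φ xs ys) g ≈ ∑[ x ← xs ] (∑[ y ← ys ] g (φ x y))
  ∑-cartesianProductWith φ []       ys = refl
  ∑-cartesianProductWith φ (x ∷ xs) ys =
    trans (∑-++ (map (φ x) ys) _) (+-cong (∑-map (φ x) ys) (∑-cartesianProductWith φ xs ys))

  ∑-filter : ∀ {P : Pred A p} (P? : Decidable P) xs {g : A → 𝕂} →
    ∑ (filter P? xs) g ≈ ∑[ x ← xs ] (if does (P? x) then g x else 0#)
  ∑-filter P? []       = refl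
  ∑-filter P? (x ∷ xs) with does (P? x)
  ... | true  = +-congˡ (∑-filter P? xs)
  ... | false = trans (∑-filter P? xs) (sym (+-identityˡ _))

  ∑-comm : ∀ (xs : List A) (ys : List B) {g : A → B → 𝕂} →
    ∑[ x ← xs ] (∑[ y ← ys ] g x y) ≈ ∑[ y ← ys ] (∑[ x ← xs ] g x y)
  ∑-comm []       ys = sym (∑-zero ys)
  ∑-comm (x ∷ xs) ys = trans (+-congˡ (∑-comm xs ys)) (sym (∑-distrib-+ ys))

  ∑-↭ : ∀ {xs ys : List A} {g : A → 𝕂} → xs ↭ ys → ∑ xs g ≈ ∑ ys g
  ∑-↭ ↭.refl                = refl
  ∑-↭ (↭.prep x xs↭ys)      = +-congˡ (∑-↭ xs↭ys)
  ∑-↭ (↭.swap x y xs↭ys)    = trans (x∙yz≈y∙xz _ _ _) (+-congˡ (+-congˡ (∑-↭ xs↭ys)))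
  ∑-↭ (↭.trans xs↭ys ys↭zs) = trans (∑-↭ xs↭ys) (∑-↭ ys↭zs)

  ∑-const : ∀ (xs : List A) y → ∑ xs (λ _ → y) ≈ length xs · y
  ∑-const []       y = refl
  ∑-const (x ∷ xs) y = +-congˡ (∑-const xs y)

  ∑-upTo-δ : ∀ {m N} {g : ℕ → 𝕂} → m < N →
    ∑[ j ← upTo N ] (if does (m ℕ.≟ j) then g j else 0#) ≈ g m
  ∑-upTo-δ {m} {suc N} {g} m<1+N = trans (+-congˡ tail≈) (cases m<1+N)
    where
    δ : ℕ → ℕ → 𝕂
    δ m j = if does (m ℕ.≟ j) then g j else 0#

    -- The tail of `upTo (suc N)` is `upTo N` shifted by one, so the recursion continues with
    -- `g ∘ suc`.
    tail≈ : foldr _+_ 0# (map (δ m) (applyUpTo suc N)) ≈ ∑ (upTo N) (δ m ∘ suc)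
    tail≈ = trans (reflexive (≡.cong (λ js → ∑ js (δ m)) (≡.sym (map-upTo suc N)))) (∑-map suc (upTo N))

    cases : ∀ {m} → m < suc N → δ m 0 + ∑ (upTo N) (δ m ∘ suc) ≈ g m
    cases {zero}  _         = trans (+-congˡ (∑-zero (upTo N))) (+-identityʳ _)
    cases {suc m} (s≤s m<N) = trans (+-identityˡ _) (∑-upTo-δ {g = g ∘ suc} m<N)

  -- After exchanging the sums, each `x` survives only at `j = φ x`, which the bound places inside
  -- the range. It serves to group basis elements by degree and edge sets by size.
  ∑-fibres : ∀ (φ : A → ℕ) N xs (h : ℕ → A → 𝕂) → (∀ {x} → x ∈ xs → φ x < N) →
    ∑[ j ← upTo N ] (∑[ x ← filter (λ x → φ x ℕ.≟ j) xs ] h j x) ≈ ∑[ x ← xs ] h (φ x) x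
  ∑-fibres φ N xs h bound = begin
    ∑[ j ← upTo N ] (∑[ x ← filter (λ x → φ x ℕ.≟ j) xs ] h j x)
      ≈⟨ ∑-cong (upTo N) (λ j → ∑-filter (λ x → φ x ℕ.≟ j) xs) ⟩
    ∑[ j ← upTo N ] (∑[ x ← xs ] (if does (φ x ℕ.≟ j) then h j x else 0#))
      ≈⟨ ∑-comm (upTo N) xs ⟩
    ∑[ x ← xs ] (∑[ j ← upTo N ] (if does (φ x ℕ.≟ j) then h j x else 0#))
      ≈⟨ ∑-cong-∈ xs (λ {x} x∈xs → ∑-upTo-δ {g = λ j → h j x} (bound x∈xs)) ⟩
    ∑[ x ← xs ] h (φ x) x ∎

  -- Graded dimensions

  -- The Poincaré polynomial at `q`, written over the basis instead of by degrees, so that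
  -- multiplicativity under `⊗` is the expansion of a product.
  qdim : 𝕂 → GradedModule → 𝕂
  qdim q N = ∑[ b ← basis N ] (q ^ degree N b)

  qdim-⊗ : ∀ q N P → qdim q (N ⊗ P) ≈ qdim q N * qdim q P
  qdim-⊗ q N P = begin
    qdim q (N ⊗ P)
      ≈⟨ ∑-cartesianProductWith _,_ (basis N) (basis P) ⟩
    ∑[ b ← basis N ] (∑[ b′ ← basis P ] (q ^ (degree N b ℕ.+ degree P b′)))
      ≈⟨ ∑-cong (basis N) (λ b → trans (∑-cong (basis P) (λ b′ → ^-homo-* q (degree N b) (degree P b′)))
                                        (sym (*-distribˡ-∑ (basis P) (q ^ degree N b)))) ⟩
    ∑[ b ← basis N ] (q ^ degree N b * qdim q P)
      ≈⟨ *-distribʳ-∑ (basis N) (qdim q P) ⟨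
    qdim q N * qdim q P ∎

  qdim-M : ∀ q → qdim q M ≈ 1# + q
  qdim-M q = +-congˡ (trans (+-identityʳ _) (*-identityʳ q))

  qdim-M⊗^ : ∀ q m → qdim q (M⊗^ m) ≈ (1# + q) ^ m
  qdim-M⊗^ q zero    = +-identityʳ _
  qdim-M⊗^ q (suc m) = trans (qdim-⊗ q M (M⊗^ m)) (*-cong (qdim-M q) (qdim-M⊗^ q m))

  fqdim-as-sum : ∀ q N → fqdim q N ≈ ∑[ P ← N ] (value P * qdim q (underlying P))
  fqdim-as-sum q N = begin
    fqdim q N
      ≈⟨ ∑-cong (upTo (suc top)) (λ j → *-distribˡ-∑ N (q ^ j)) ⟩
    ∑[ j ← upTo (suc top) ] (∑[ P ← N ] (q ^ j * (dim (underlying P) j · value P)))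
      ≈⟨ ∑-comm (upTo (suc top)) N ⟩
    ∑[ P ← N ] (∑[ j ← upTo (suc top) ] (q ^ j * (dim (underlying P) j · value P)))
      ≈⟨ ∑-cong-∈ N (λ {P} P∈N → summand P (∈⇒≤foldr-⊔ (∈-map⁺ (topDegree ∘ underlying) P∈N))) ⟩
    ∑[ P ← N ] (value P * qdim q (underlying P)) ∎
    where
    top = foldr ℕ._⊔_ 0 (map (topDegree ∘ underlying) N)

    summand : ∀ P → topDegree (underlying P) ≤ top →
      ∑[ j ← upTo (suc top) ] (q ^ j * (dim (underlying P) j · value P)) ≈ value P * qdim q (underlying P)
    summand (P at v) P≤top = begin
      ∑[ j ← upTo (suc top) ] (q ^ j * (dim P j · v))
        -- The multiple `dim P j · v` is spread out as a constant sum over the basis elements of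
        -- degree `j`, ready for regrouping by degree.
        ≈⟨ ∑-cong (upTo (suc top)) (λ j →
             trans (*-congˡ (sym (∑-const (part j) v))) (*-distribˡ-∑ (part j) (q ^ j))) ⟩
      ∑[ j ← upTo (suc top) ] (∑[ b ← part j ] (q ^ j * v))
        ≈⟨ ∑-fibres (degree P) (suc top) (basis P) (λ j _ → q ^ j * v)
             (λ b∈ → s≤s (ℕ.≤-trans (∈⇒≤foldr-⊔ (∈-map⁺ (degree P) b∈)) P≤top)) ⟩
      ∑[ b ← basis P ] (q ^ degree P b * v)
        ≈⟨ ∑-cong (basis P) (λ b → *-comm (q ^ degree P b) v) ⟩
      ∑[ b ← basis P ] (v * q ^ degree P b)
        ≈⟨ *-distribˡ-∑ (basis P) v ⟨
      v * qdim q P ∎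
      where
      part : ℕ → List (Basis P)
      part j = filter (λ b → degree P b ℕ.≟ j) (basis P)

  -- Harmonic functions

  private
    variable
      n : ℕ

  -- The condition is a Boolean indicator, not a filter: fixing the first coordinates of both sets
  -- then lets the subset test compute, which drives the inductions below.
  ∑⟨_⟩ : (Subset n → Bool) → (Subset n → 𝕂) → 𝕂
  ∑⟨ β ⟩ g = ∑[ Z ← subsets _ ] (if β Z then g Z else 0#)

  if-cong : ∀ b {x y} → x ≈ y → (if b then x else 0#) ≈ (if b then y else 0#)
  if-cong true  x≈y = x≈y
  if-cong false x≈y = refl

  ∑⟨⟩-cong : ∀ (β : Subset n → Bool) {g h} → (∀ Z → g Z ≈ h Z) → ∑⟨ β ⟩ g ≈ ∑⟨ β ⟩ h
  ∑⟨⟩-cong {n} β g≈h = ∑-cong (subsets n) (λ Z → if-cong (β Z) (g≈h Z))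

  ∑⟨⟩-zero : ∀ (β : Subset n → Bool) → ∑⟨ β ⟩ (λ _ → 0#) ≈ 0#
  ∑⟨⟩-zero {n} β = trans (∑-cong (subsets n) (λ Z → if-zero (β Z))) (∑-zero (subsets n))
    where
    if-zero : ∀ b → (if b then 0# else 0#) ≈ 0#
    if-zero true  = refl
    if-zero false = refl

  ∑⟨⟩-distrib-+ : ∀ (β : Subset n → Bool) g h → ∑⟨ β ⟩ (λ Z → g Z + h Z) ≈ ∑⟨ β ⟩ g + ∑⟨ β ⟩ h
  ∑⟨⟩-distrib-+ {n} β g h =
    trans (∑-cong (subsets n) (λ Z → if-+ (β Z))) (∑-distrib-+ (subsets n))
    where
    if-+ : ∀ b {x y} → (if b then x + y else 0#) ≈ (if b then x else 0#) + (if b then y else 0#)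
    if-+ true  = refl
    if-+ false = sym (+-identityˡ 0#)

  *-distribˡ-∑⟨⟩ : ∀ (β : Subset n → Bool) x g → x * ∑⟨ β ⟩ g ≈ ∑⟨ β ⟩ (λ Z → x * g Z)
  *-distribˡ-∑⟨⟩ {n} β x g =
    trans (*-distribˡ-∑ (subsets n) x) (∑-cong (subsets n) (λ Z → *-if (β Z)))
    where
    *-if : ∀ b {y} → x * (if b then y else 0#) ≈ (if b then x * y else 0#)
    *-if true  = refl
    *-if false = zeroʳ x

  ·-distrib-∑⟨⟩ : ∀ (β : Subset n → Bool) m g → m · ∑⟨ β ⟩ g ≈ ∑⟨ β ⟩ (λ Z → m · g Z)
  ·-distrib-∑⟨⟩ β zero    g = sym (∑⟨⟩-zero β)
  ·-distrib-∑⟨⟩ β (suc m) g =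
    trans (+-congˡ (·-distrib-∑⟨⟩ β m g)) (sym (∑⟨⟩-distrib-+ β g (λ Z → m · g Z)))

  ∑⟨⟩-split : ∀ (β : Subset (suc n) → Bool) g →
    ∑⟨ β ⟩ g ≈ ∑⟨ β ∘ (outside ∷_) ⟩ (g ∘ (outside ∷_)) + ∑⟨ β ∘ (inside ∷_) ⟩ (g ∘ (inside ∷_))
  ∑⟨⟩-split {n} β g =
    trans (∑-cartesianProductWith _∷_ (outside ∷ inside ∷ []) (subsets n)) (+-congˡ (+-identityʳ _))

  -- The coefficient of x^Y in p(x + (1,...,1)), where p is the polynomial of `g`.
  up : (Subset n → 𝕂) → Subset n → 𝕂
  up g Y = ∑⟨ (λ Z → does (Y ⊆? Z)) ⟩ g

  up-inside : ∀ (g : Subset (suc n) → 𝕂) Y → up g (inside ∷ Y) ≈ up (g ∘ (inside ∷_)) Y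
  up-inside {n} g Y = trans (∑⟨⟩-split (λ Z → does (inside ∷ Y ⊆? Z)) g)
                        (trans (+-congʳ (∑-zero (subsets n))) (+-identityˡ _))

  up-outside : ∀ (g : Subset (suc n) → 𝕂) Y →
    up g (outside ∷ Y) ≈ up (g ∘ (outside ∷_)) Y + up (g ∘ (inside ∷_)) Y
  up-outside g Y = ∑⟨⟩-split (λ Z → does (outside ∷ Y ⊆? Z)) g

  -- The value of the polynomial of `g` at the indicator vector of `X`.
  down : (Subset n → 𝕂) → Subset n → 𝕂
  down g X = ∑⟨ (λ Z → does (Z ⊆? X)) ⟩ g

  down-inside : ∀ (g : Subset (suc n) → 𝕂) X →
    down g (inside ∷ X) ≈ down (g ∘ (outside ∷_)) X + down (g ∘ (inside ∷_)) X
  down-inside g X = ∑⟨⟩-split (λ Z → does (Z ⊆? inside ∷ X)) g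

  down-outside : ∀ (g : Subset (suc n) → 𝕂) X → down g (outside ∷ X) ≈ down (g ∘ (outside ∷_)) X
  down-outside {n} g X = trans (∑⟨⟩-split (λ Z → does (Z ⊆? outside ∷ X)) g)
                           (trans (+-congˡ (∑-zero (subsets n))) (+-identityʳ _))

  -- On the polynomial of g this is the sum of all partial derivatives.

  ∂ : (Subset n → 𝕂) → Subset n → 𝕂
  ∂ g []            = 0#
  ∂ g (outside ∷ Y) = g (inside ∷ Y) + ∂ (g ∘ (outside ∷_)) Y
  ∂ g (inside  ∷ Y) = ∂ (g ∘ (inside ∷_)) Y

  -- Both sides sum g Z over the pairs (y , Z) with Y ⊆ Z and y ∈ Z; on the
  -- right these are split according to whether y ∈ Y.

  up-size : ∀ (g : Subset n → 𝕂) Y → up (λ Z → ∣ Z ∣ · g Z) Y ≈ ∣ Y ∣ · up g Y + up (∂ g) Y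
  up-size g [] = sym (+-identityˡ _)
  up-size g (inside ∷ Y) = begin
    up (λ Z → ∣ Z ∣ · g Z) (inside ∷ Y)
      ≈⟨ up-inside (λ Z → ∣ Z ∣ · g Z) Y ⟩
    up (λ Z → g₁ Z + ∣ Z ∣ · g₁ Z) Y
      ≈⟨ ∑⟨⟩-distrib-+ _ g₁ (λ Z → ∣ Z ∣ · g₁ Z) ⟩
    up g₁ Y + up (λ Z → ∣ Z ∣ · g₁ Z) Y
      ≈⟨ +-congˡ (up-size g₁ Y) ⟩
    up g₁ Y + (∣ Y ∣ · up g₁ Y + up (∂ g₁) Y)
      -- The pairs whose `y` is the new point account for the extra `up g₁ Y`; that point lies in
      -- the enlarged `Y`, so they raise the multiplicity to `suc ∣ Y ∣`.
      ≈⟨ +-assoc _ _ _ ⟨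
    suc ∣ Y ∣ · up g₁ Y + up (∂ g₁) Y
      ≈⟨ +-cong (·-congʳ (suc ∣ Y ∣) (up-inside g Y)) (up-inside (∂ g) Y) ⟨
    suc ∣ Y ∣ · up g (inside ∷ Y) + up (∂ g) (inside ∷ Y) ∎
    where g₁ = g ∘ (inside ∷_)
  up-size g (outside ∷ Y) = begin
    up (λ Z → ∣ Z ∣ · g Z) (outside ∷ Y)
      ≈⟨ up-outside (λ Z → ∣ Z ∣ · g Z) Y ⟩
    up (λ Z → ∣ Z ∣ · g₀ Z) Y + up (λ Z → g₁ Z + ∣ Z ∣ · g₁ Z) Y
      ≈⟨ +-cong (up-size g₀ Y)
                (trans (∑⟨⟩-distrib-+ _ g₁ (λ Z → ∣ Z ∣ · g₁ Z)) (+-congˡ (up-size g₁ Y))) ⟩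
    (∣ Y ∣ · up g₀ Y + up (∂ g₀) Y) + (up g₁ Y + (∣ Y ∣ · up g₁ Y + up (∂ g₁) Y))
      ≈⟨ +-congˡ (x∙yz≈y∙xz _ _ _) ⟩
    (∣ Y ∣ · up g₀ Y + up (∂ g₀) Y) + (∣ Y ∣ · up g₁ Y + (up g₁ Y + up (∂ g₁) Y))
      ≈⟨ interchange _ _ _ _ ⟩
    (∣ Y ∣ · up g₀ Y + ∣ Y ∣ · up g₁ Y) + (up (∂ g₀) Y + (up g₁ Y + up (∂ g₁) Y))
      ≈⟨ +-cong (sym (·-distrib-+ _ _ ∣ Y ∣))
                (trans (x∙yz≈y∙xz _ _ _) (sym (+-assoc _ _ _))) ⟩
    ∣ Y ∣ · (up g₀ Y + up g₁ Y) + ((up g₁ Y + up (∂ g₀) Y) + up (∂ g₁) Y)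
      -- Here the new point is not in `Y`, so the extra `up g₁ Y` comes from the leading term of
      -- `∂ g` at sets avoiding that point.
      ≈⟨ +-cong (·-congʳ ∣ Y ∣ (up-outside g Y))
                (trans (up-outside (∂ g) Y) (+-congʳ (∑⟨⟩-distrib-+ _ g₁ (∂ g₀)))) ⟨
    ∣ Y ∣ · up g (outside ∷ Y) + up (∂ g) (outside ∷ Y) ∎
    where
    g₀ = g ∘ (outside ∷_)
    g₁ = g ∘ (inside ∷_)

  -- Superset sums and derivatives of functions supported on a single size

  up-zero : ∀ {g : Subset n → 𝕂} Y → (∀ Z → ∣ Y ∣ ≤ ∣ Z ∣ → g Z ≈ 0#) → up g Y ≈ 0#
  up-zero [] g≈0 = trans (+-identityʳ _) (g≈0 [] ℕ.z≤n)
  up-zero {g = g} (inside ∷ Y) g≈0 =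
    trans (up-inside g Y) (up-zero Y (λ Z Y≤Z → g≈0 (inside ∷ Z) (s≤s Y≤Z)))
  up-zero {g = g} (outside ∷ Y) g≈0 = trans (up-outside g Y) (trans
    (+-cong (up-zero Y (λ Z → g≈0 (outside ∷ Z)))
            (up-zero Y (λ Z Y≤Z → g≈0 (inside ∷ Z) (ℕ.m≤n⇒m≤1+n Y≤Z))))
    (+-identityˡ 0#))

  -- The only superset of `Y` having the size of `Y` is `Y` itself.
  up-self : ∀ {g : Subset n → 𝕂} Y → (∀ Z → ∣ Z ∣ ≢ ∣ Y ∣ → g Z ≈ 0#) → up g Y ≈ g Y
  up-self [] g≈0 = +-identityʳ _
  up-self {g = g} (inside ∷ Y) g≈0 =
    trans (up-inside g Y) (up-self Y (λ Z Z≢Y → g≈0 (inside ∷ Z) (Z≢Y ∘ ℕ.suc-injective)))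
  up-self {g = g} (outside ∷ Y) g≈0 = trans (up-outside g Y) (trans
    (+-cong (up-self Y (λ Z → g≈0 (outside ∷ Z)))
            (up-zero Y (λ Z Y≤Z → g≈0 (inside ∷ Z) (ℕ.>⇒≢ (s≤s Y≤Z)))))
    (+-identityʳ _))

  -- The supersets with one more element are `Y` with a single outside point added, and `∂` sums
  -- over exactly these.
  up-∂ : ∀ {g : Subset n → 𝕂} Y → (∀ Z → ∣ Z ∣ ≢ suc ∣ Y ∣ → g Z ≈ 0#) → up g Y ≈ ∂ g Y
  up-∂ [] g≈0 = trans (+-identityʳ _) (g≈0 [] (λ ()))
  up-∂ {g = g} (inside ∷ Y) g≈0 =
    trans (up-inside g Y) (up-∂ Y (λ Z Z≢ → g≈0 (inside ∷ Z) (Z≢ ∘ ℕ.suc-injective)))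
  up-∂ {g = g} (outside ∷ Y) g≈0 = trans (up-outside g Y) (trans
    (+-cong (up-∂ Y (λ Z → g≈0 (outside ∷ Z)))
            (up-self Y (λ Z Z≢ → g≈0 (inside ∷ Z) (Z≢ ∘ ℕ.suc-injective))))
    (+-comm _ _))

  ∂-zero : ∀ {g : Subset n → 𝕂} Y → (∀ Z → ∣ Z ∣ ≡ suc ∣ Y ∣ → g Z ≈ 0#) → ∂ g Y ≈ 0#
  ∂-zero []            g≈0 = refl
  ∂-zero (inside  ∷ Y) g≈0 = ∂-zero Y (λ Z Z≡ → g≈0 (inside ∷ Z) (≡.cong suc Z≡))
  ∂-zero (outside ∷ Y) g≈0 = trans
    (+-cong (g≈0 (inside ∷ Y) ≡.refl) (∂-zero Y (λ Z → g≈0 (outside ∷ Z))))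
    (+-identityˡ 0#)

  -- Inclusion–exclusion; in terms of polynomials, p(1 − x) is obtained from
  -- p(x + 1) by substituting − x.

  down-∁ : ∀ (g : Subset n → 𝕂) X → down g (∁ X) ≈ down (λ Z → (- 1#) ^ ∣ Z ∣ * up g Z) X
  down-∁ g [] = +-congʳ (sym (trans (*-identityˡ _) (+-identityʳ _)))
  down-∁ g (inside ∷ X) = begin
    down g (outside ∷ ∁ X)
      ≈⟨ down-outside g (∁ X) ⟩
    down g₀ (∁ X)
      ≈⟨ down-∁ g₀ X ⟩
    down (λ Z → (- 1#) ^ ∣ Z ∣ * up g₀ Z) X
      -- Adjoining the new point to `Z` flips the sign, so the two copies of `up g₁ Z` cancel, where
      -- `g₁` is `g` on sets containing that point.
      ≈⟨ ∑⟨⟩-cong _ (λ Z → trans (+-congʳ (*-congˡ (up-outside g Z)))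
            (trans (+-congˡ (*-congˡ (up-inside g Z))) (cancel ((- 1#) ^ ∣ Z ∣) _ _))) ⟨
    down (λ Z → (- 1#) ^ ∣ Z ∣ * up g (outside ∷ Z) + (- 1#) ^ suc ∣ Z ∣ * up g (inside ∷ Z)) X
      ≈⟨ ∑⟨⟩-distrib-+ (λ Z → does (Z ⊆? X)) _ _ ⟩
    down (λ Z → (- 1#) ^ ∣ Z ∣ * up g (outside ∷ Z)) X
      + down (λ Z → (- 1#) ^ suc ∣ Z ∣ * up g (inside ∷ Z)) X
      ≈⟨ down-inside (λ Z → (- 1#) ^ ∣ Z ∣ * up g Z) X ⟨
    down (λ Z → (- 1#) ^ ∣ Z ∣ * up g Z) (inside ∷ X) ∎
    where
    g₀ = g ∘ (outside ∷_)

    cancel : ∀ s u v → s * (u + v) + (- 1# * s) * v ≈ s * u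
    cancel s u v = begin
      s * (u + v) + (- 1# * s) * v  ≈⟨ +-cong (distribˡ s u v) (trans (*-assoc _ _ _) (-1*x≈-x _)) ⟩
      (s * u + s * v) + - (s * v)   ≈⟨ +-assoc _ _ _ ⟩
      s * u + (s * v + - (s * v))   ≈⟨ +-congˡ (-‿inverseʳ _) ⟩
      s * u + 0#                    ≈⟨ +-identityʳ _ ⟩
      s * u                         ∎
  down-∁ g (outside ∷ X) = begin
    down g (inside ∷ ∁ X)
      ≈⟨ down-inside g (∁ X) ⟩
    down g₀ (∁ X) + down g₁ (∁ X)
      ≈⟨ +-cong (down-∁ g₀ X) (down-∁ g₁ X) ⟩
    down (λ Z → (- 1#) ^ ∣ Z ∣ * up g₀ Z) X + down (λ Z → (- 1#) ^ ∣ Z ∣ * up g₁ Z) X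
      ≈⟨ ∑⟨⟩-distrib-+ (λ Z → does (Z ⊆? X)) _ _ ⟨
    down (λ Z → (- 1#) ^ ∣ Z ∣ * up g₀ Z + (- 1#) ^ ∣ Z ∣ * up g₁ Z) X
      ≈⟨ ∑⟨⟩-cong _ (λ Z → trans (*-congˡ (up-outside g Z)) (distribˡ _ _ _)) ⟨
    down (λ Z → (- 1#) ^ ∣ Z ∣ * up g (outside ∷ Z)) X
      ≈⟨ down-outside (λ Z → (- 1#) ^ ∣ Z ∣ * up g Z) X ⟨
    down (λ Z → (- 1#) ^ ∣ Z ∣ * up g Z) (outside ∷ X) ∎
    where
    g₀ = g ∘ (outside ∷_)
    g₁ = g ∘ (inside ∷_)

  -- Common copies of `x` are cancelled until one side is zero; the other is then a positive
  -- multiple of `x`, and torsion-freeness applies.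
  ·-injectiveˡ : TorsionFree → ∀ {m n x} → m · x ≈ n · x → m ≢ n → x ≈ 0#
  ·-injectiveˡ tf {zero}  {zero}  eq 0≢0 = contradiction ≡.refl 0≢0
  ·-injectiveˡ tf {zero}  {suc n} eq _   = tf n _ (sym eq)
  ·-injectiveˡ tf {suc m} {zero}  eq _   = tf m _ eq
  ·-injectiveˡ tf {suc m} {suc n} eq m≢n = ·-injectiveˡ tf (+-cancelˡ _ _ _ eq) (m≢n ∘ ≡.cong suc)

  -- Translation invariance and complementation for harmonic functions

  module _ {d} (g : Subset n → 𝕂)
    (homogeneous : ∀ Z → ∣ Z ∣ ≢ d → g Z ≈ 0#)
    (harmonic : ∀ Y → suc ∣ Y ∣ ≡ d → up g Y ≈ 0#)
    where

    -- If `Y` has one element fewer than `d`, the derivative is the superset sum that harmonicity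
    -- kills. For any other size it reads only values that vanish by homogeneity.
    ∂-harmonic : ∀ Y → ∂ g Y ≈ 0#
    ∂-harmonic Y with suc ∣ Y ∣ ℕ.≟ d
    ... | yes ≡.refl = trans (sym (up-∂ Y homogeneous)) (harmonic Y ≡.refl)
    ... | no  ≢d     = ∂-zero Y (λ Z Z≡ → homogeneous Z (≢d ∘ ≡.trans (≡.sym Z≡)))

    -- This is p(x + (1,...,1)) = p(x), coefficient by coefficient. Away from size `d`, double
    -- counting makes `∣ Y ∣` and `d` copies of `up g Y` equal, which forces it to vanish.
    up-harmonic : TorsionFree → ∀ Y → up g Y ≈ g Y
    up-harmonic tf Y with ∣ Y ∣ ℕ.≟ d
    ... | yes ≡.refl = up-self Y homogeneous
    ... | no  Y≢d    = trans (·-injectiveˡ tf same-multiple Y≢d) (sym (homogeneous Y Y≢d))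
      where
      ∣∣·≈d· : ∀ Z → ∣ Z ∣ · g Z ≈ d · g Z
      ∣∣·≈d· Z with ∣ Z ∣ ℕ.≟ d
      ... | yes ≡.refl = refl
      ... | no  Z≢d    = trans (·-zero ∣ Z ∣) (sym (·-zero d))
        where
        ·-zero : ∀ m → m · g Z ≈ 0#
        ·-zero zero    = refl
        ·-zero (suc m) = trans (+-cong (homogeneous Z Z≢d) (·-zero m)) (+-identityˡ 0#)

      same-multiple : ∣ Y ∣ · up g Y ≈ d · up g Y
      same-multiple = begin
        ∣ Y ∣ · up g Y                ≈⟨ +-identityʳ _ ⟨
        ∣ Y ∣ · up g Y + 0#           ≈⟨ +-congˡ (up-zero Y (λ Z _ → ∂-harmonic Z)) ⟨
        ∣ Y ∣ · up g Y + up (∂ g) Y   ≈⟨ up-size g Y ⟨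
        -- Since `g` lives on sets of size `d`, the weight `∣ Z ∣` can be replaced by `d`: Euler's
        -- identity for homogeneous polynomials.
        up (λ Z → ∣ Z ∣ · g Z) Y      ≈⟨ ∑⟨⟩-cong _ ∣∣·≈d· ⟩
        up (λ Z → d · g Z) Y          ≈⟨ ·-distrib-∑⟨⟩ _ d g ⟨
        d · up g Y                    ∎

    down-∁-harmonic : TorsionFree → ∀ X → down g (∁ X) ≈ (- 1#) ^ d * down g X
    down-∁-harmonic tf X = begin
      down g (∁ X)                              ≈⟨ down-∁ g X ⟩
      down (λ Z → (- 1#) ^ ∣ Z ∣ * up g Z) X    ≈⟨ ∑⟨⟩-cong _ sign ⟩
      down (λ Z → (- 1#) ^ d * g Z) X           ≈⟨ *-distribˡ-∑⟨⟩ _ ((- 1#) ^ d) g ⟨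
      (- 1#) ^ d * down g X                     ∎
      where
      sign : ∀ Z → (- 1#) ^ ∣ Z ∣ * up g Z ≈ (- 1#) ^ d * g Z
      sign Z with ∣ Z ∣ ℕ.≟ d
      ... | yes ≡.refl = *-congˡ (up-harmonic tf Z)
      ... | no  Z≢d    = trans (*-congˡ up≈0) (trans (zeroʳ _)
                           (sym (trans (*-congˡ (homogeneous Z Z≢d)) (zeroʳ _))))
        where
        up≈0 : up g Z ≈ 0#
        up≈0 = trans (up-harmonic tf Z) (homogeneous Z Z≢d)

  -- From functions on `Ω[ d ] n` to all subsets, and the Euler characteristic

  module _ {n d} (f : Ω[ d ] n → 𝕂) where

    -- Extension by zero: `ofSize d Z` has at most one element, so the sum is either the value of
    -- `f` or empty.
    extend : Subset n → 𝕂
    extend Z = ∑ (ofSize d Z) f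

    extend-homogeneous : ∀ Z → ∣ Z ∣ ≢ d → extend Z ≈ 0#
    extend-homogeneous Z Z≢d with ∣ Z ∣ ℕ.≟ d
    ... | yes Z≡d = contradiction Z≡d Z≢d
    ... | no  _   = refl

    ∑-Ω-elements : ∀ (β : Subset n → Bool) →
      ∑[ Z ← Ω-elements d n ] (if β (proj₁ Z) then f Z else 0#) ≈ ∑⟨ β ⟩ extend
    ∑-Ω-elements β = trans (∑-concatMap (ofSize d) (subsets n)) (∑-cong (subsets n) pointwise)
      where
      pointwise : ∀ Z → ∑[ Z′ ← ofSize d Z ] (if β (proj₁ Z′) then f Z′ else 0#)
                        ≈ (if β Z then extend Z else 0#)
      pointwise Z with ∣ Z ∣ ℕ.≟ d | β Z in βZ
      -- The occurrence of `β Z` on the left appears only once `ofSize` has reduced, hence is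
      -- rewritten through the equation `βZ`.
      ... | yes _ | true  = +-congʳ (reflexive (≡.cong (λ b → if b then _ else 0#) βZ))
      ... | yes _ | false = trans (+-identityʳ _) (reflexive (≡.cong (λ b → if b then _ else 0#) βZ))
      ... | no  _ | true  = refl
      ... | no  _ | false = refl

    tilde≈down : ∀ X → tilde f X ≈ down extend X
    tilde≈down X = trans (∑-filter (λ Z → proj₁ Z ⊆? X) (Ω-elements d n))
                         (∑-Ω-elements (λ Z → does (Z ⊆? X)))

    γ≈up : ∀ Y (1+Y≡d : suc ∣ Y ∣ ≡ d) → γ f (Y , 1+Y≡d) ≈ up extend Y
    γ≈up Y _ = trans (∑-cong (Ω-elements d n) (λ Z → *-indicator (does (Y ⊆? proj₁ Z))))
                     (∑-Ω-elements (λ Z → does (Y ⊆? Z)))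
      where
      *-indicator : ∀ b {x} → x * (if b then 1# else 0#) ≈ (if b then x else 0#)
      *-indicator true  = *-identityʳ _
      *-indicator false = zeroʳ _

    tilde-∁ : TorsionFree → Harm d f → ∀ X → tilde f (∁ X) ≈ (- 1#) ^ d * tilde f X
    tilde-∁ tf harm X = begin
      tilde f (∁ X)
        ≈⟨ tilde≈down (∁ X) ⟩
      down extend (∁ X)
        ≈⟨ down-∁-harmonic extend extend-homogeneous
             (λ Y 1+Y≡d → trans (sym (γ≈up Y 1+Y≡d)) (harm (Y , 1+Y≡d))) tf X ⟩
      (- 1#) ^ d * down extend X
        ≈⟨ *-congˡ (tilde≈down X) ⟨
      (- 1#) ^ d * tilde f X ∎

    fqdim-C : ∀ (G : Graph n) s q i → fqdim q (C f G s i)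
      ≈ ∑[ ε ← filter (λ ε → ∣ ε ∣ ℕ.≟ i) (subsets n) ] (tilde f ε * (1# + q) ^ k G (spanning s ε))
    fqdim-C G s q i = begin
      fqdim q (C f G s i)
        ≈⟨ fqdim-as-sum q (C f G s i) ⟩
      ∑[ P ← C f G s i ] (value P * qdim q (underlying P))
        ≈⟨ ∑-map (λ ε → M⊗^ (k G (spanning s ε)) at tilde f ε) slice ⟩
      ∑[ ε ← slice ] (tilde f ε * qdim q (M⊗^ (k G (spanning s ε))))
        ≈⟨ ∑-cong slice (λ ε → *-congˡ (qdim-M⊗^ q (k G (spanning s ε)))) ⟩
      ∑[ ε ← slice ] (tilde f ε * (1# + q) ^ k G (spanning s ε)) ∎
      where slice = filter (λ ε → ∣ ε ∣ ℕ.≟ i) (subsets n)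

    -- With `A` the preimage of `ε` under `s`, the removed edges carry the labels in `∁ ε`, and
    -- passing from `∁ ε` to `ε` costs (-1)^d. The total sign (-1)^(i+d) is (-1)^(i+1) for odd `d`
    -- and (-1)^i for even `d`.
    χ-as-euler-characteristic : TorsionFree → Harm d f → ∀ (G : Graph n) s → IsLabel s → ∀ q →
      χ f G s (1# + q) ≈ ∑[ i ← upTo (suc n) ] ((- 1#) ^ (i ℕ.+ d) * fqdim q (C f G s i))
    χ-as-euler-characteristic tf harm G s s-label q = begin
      χ f G s (1# + q)
        ≈⟨ ∑-↭ (spanning-↭ s-label) ⟨
      ∑[ A ← map (spanning s) (subsets n) ] (tilde f (image s (∁ A)) * (- 1#) ^ ∣ A ∣ * (1# + q) ^ k G A)
        ≈⟨ ∑-map (spanning s) (subsets n) ⟩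
      ∑[ ε ← subsets n ] (tilde f (image s (∁ (spanning s ε))) * (- 1#) ^ ∣ spanning s ε ∣ * weight ε)
        ≈⟨ ∑-cong (subsets n) (λ ε → trans (*-congʳ (complement ε)) (*-assoc _ _ _)) ⟩
      ∑[ ε ← subsets n ] ((- 1#) ^ (∣ ε ∣ ℕ.+ d) * (tilde f ε * weight ε))
        -- Edge sets are grouped by size; sizes run from 0 to `n` inclusive, hence `suc n` cochain
        -- groups.
        ≈⟨ ∑-fibres ∣_∣ (suc n) (subsets n) (λ i ε → (- 1#) ^ (i ℕ.+ d) * (tilde f ε * weight ε))
             (λ {ε} _ → s≤s (∣p∣≤n ε)) ⟨
      ∑[ i ← upTo (suc n) ] (∑[ ε ← slice i ] ((- 1#) ^ (i ℕ.+ d) * (tilde f ε * weight ε)))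
        ≈⟨ ∑-cong (upTo (suc n)) (λ i →
             trans (*-congˡ (fqdim-C G s q i)) (*-distribˡ-∑ (slice i) ((- 1#) ^ (i ℕ.+ d)))) ⟨
      ∑[ i ← upTo (suc n) ] ((- 1#) ^ (i ℕ.+ d) * fqdim q (C f G s i)) ∎
      where
      weight : Subset n → 𝕂
      weight ε = (1# + q) ^ k G (spanning s ε)

      slice : ℕ → List (Subset n)
      slice i = filter (λ ε → ∣ ε ∣ ℕ.≟ i) (subsets n)

      complement : ∀ ε → tilde f (image s (∁ (spanning s ε))) * (- 1#) ^ ∣ spanning s ε ∣
                         ≈ (- 1#) ^ (∣ ε ∣ ℕ.+ d) * tilde f ε
      complement ε = begin
        tilde f (image s (∁ (spanning s ε))) * (- 1#) ^ ∣ spanning s ε ∣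
          ≡⟨ ≡.cong₂ (λ X m → tilde f X * (- 1#) ^ m) (image-∁-spanning s-label ε) (∣spanning∣ s-label ε) ⟩
        tilde f (∁ ε) * (- 1#) ^ ∣ ε ∣
          ≈⟨ *-congʳ (tilde-∁ tf harm ε) ⟩
        ((- 1#) ^ d * tilde f ε) * (- 1#) ^ ∣ ε ∣
          ≈⟨ *-comm _ _ ⟩
        (- 1#) ^ ∣ ε ∣ * ((- 1#) ^ d * tilde f ε)
          ≈⟨ *-assoc _ _ _ ⟨
        ((- 1#) ^ ∣ ε ∣ * (- 1#) ^ d) * tilde f ε
          ≈⟨ *-congʳ (^-homo-* (- 1#) ∣ ε ∣ d) ⟨
        (- 1#) ^ (∣ ε ∣ ℕ.+ d) * tilde f ε ∎

theorem7p1 : ∀ {c ℓ} (K : CommutativeRing c ℓ) →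
    let open CommutativeRing K
        open Weighted K in
    TorsionFree →
    ∀ (n : ℕ) (G : Graph n) (d : ℕ) (f : Ω[ d ] n → Carrier) → Harm d f →
    (∀ (s : Fin n → Fin n) → IsLabel s → ∀ q →
      χ f G s (1# + q) ≈ ∑[ i ← upTo (suc n) ] ((- 1#) ^ (i ℕ.+ d) * fqdim q (C f G s i)))
    ×
    (∀ q →
      χ̂ f G (1# + q)
        ≈ ∑[ s ← labels n ] (∑[ i ← upTo (suc n) ] ((- 1#) ^ (i ℕ.+ d) * fqdim q (C f G s i))))
theorem7p1 K tf n G d f harm =
  -- Membership in the filtered list `labels n` supplies the proof that `s` is a label, so the first
  -- identity can be summed term by term.
  χ≈ , λ q → ∑-cong-∈ K (labels n) (λ {s} s∈ → χ≈ s (proj₂ (∈-filter⁻ isLabel? {xs = candidates} s∈)) q)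
  where
  χ≈ = χ-as-euler-characteristic K f tf harm G
  candidates = map lookup (vectors (allFin n) n)
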